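{- $\text{HG}_s(\mathcal{P}etal)= 4s(s+1)-2$. More precisely, a) $\text{HG}_s(Pe_n) < 4s(s+1)-1$ for all $n$; b) $\text{HG}_s(Pe_n) = 4s(s+1)-2$ for large $n$.
   Context: Hat guessing game $\langle G, h, g\rangle$: a sage sits at each vertex $v$ of the graph $G$; an adversary puts on the head of each sage $v$ a hat whose color is chosen from $\{0,1,\dots,h(v)-1\}$; each sage sees the hat colors of his neighbours but not his own; without communication, each sage $v$ names a list of $g(v)$ colors, determined by a deterministic strategy (fixed in advance and known to the adversary) from the colors he sees. The game is winning if there is a strategy guaranteeing that for every hat assignment at least one sage's list contains his own hat color. For a graph $G$ and integer $s\ge 1$, $\text{HG}_s(G)$ is the maximal $k$ such that the game with $h$ constantly equal to $k$ and $g$ constantly equal to $s$ is winning. For a class $\mathcal{C}$ of graphs, $\text{HG}_s(\mathcal{C})=\sup\{\text{HG}_s(G): G\in\mathcal{C}\}$. The petal $Pe_n$ is the graph obtained from the path $P_n$ ($n\ge 1$ vertices) by adding a vertex (the stem) adjacent to every vertex of $P_n$; $\mathcal{P}etal$ is the class of all petals. -}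

module Defs where

open import Data.Nat using (ℕ; zero; suc; _+_; _*_; _∸_; _≤_)
open import Data.Fin using (Fin; toℕ)
import Data.Fin as F
open import Data.Vec using (Vec)
open import Data.Vec.Membership.Propositional using (_∈_)
open import Data.Product using (Σ; ∃; _×_)
open import Data.Sum using (_⊎_)
open import Data.Empty using (⊥)
open import Data.Unit using (⊤)
open import Relation.Binary.PropositionalEquality using (_≡_)

record Graph : Set₁ where
  field
    size : ℕ
    Adj  : Fin size → Fin size → Set
open Graph public

Coloring : Graph → ℕ → Set
Coloring G k = Fin (size G) → Fin k

-- A guessing profile: each sage names a list of s colours (repetitions
-- allowed, i.e. at most s distinct colours) as a function of the whole
-- colouring; it is a legal strategy only if it depends on neighbours only.
Guessing : Graph → ℕ → ℕ → Set
Guessing G s k = (v : Fin (size G)) → Coloring G k → Vec (Fin k) s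

SeesOnlyNeighbours : (G : Graph) (s k : ℕ) → Guessing G s k → Set
SeesOnlyNeighbours G s k f =
  (v : Fin (size G)) (c c' : Coloring G k) →
  ((u : Fin (size G)) → Adj G v u → c u ≡ c' u) → f v c ≡ f v c'

Winning : Graph → ℕ → ℕ → Set
Winning G s k =
  Σ (Guessing G s k) λ f → SeesOnlyNeighbours G s k f ×
    ((c : Coloring G k) → ∃ λ v → c v ∈ f v c)

HG<  : Graph → ℕ → ℕ → Set
HG< G s K = (k : ℕ) → K ≤ k → Winning G s k → ⊥

HG≡ : Graph → ℕ → ℕ → Set
HG≡ G s K = Winning G s K × HG< G s (suc K)

-- Petal Pe_n: vertex 0 is the stem, vertex (suc i) is the i-th path vertex.
PetalAdj : (n : ℕ) → Fin (suc n) → Fin (suc n) → Set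
PetalAdj n F.zero    F.zero    = ⊥
PetalAdj n F.zero    (F.suc j) = ⊤
PetalAdj n (F.suc i) F.zero    = ⊤
PetalAdj n (F.suc i) (F.suc j) = suc (toℕ i) ≡ toℕ j ⊎ suc (toℕ j) ≡ toℕ i

Petal : ℕ → Graph
Petal n = record { size = suc n ; Adj = PetalAdj n }

{-# OPTIONS --safe #-}

-- Fix the colour x of the stem: the path vertices then play an s-guess game f_x on
-- a path, and the stem survives exactly when every path colouring defeats f_x for
-- at most s values of x.  Hence the petal is winning iff, for any s + 1 stem colours,
-- the union of the corresponding path strategies wins, where each path vertex
-- makes g = s (s + 1) guesses.  On a path with g guesses the threshold is k = 4 g - 2.
--
-- Let R be the set of pairs (a , b) such that vertices i - 1 and i can be coloured
-- a and b with all vertices before i wrong.  If every b has at least d predecessors in R,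
-- then fixing the colour c of vertex i + 1 kills at most g k / d values of b.
-- For k ≥ 4 g - 1 and d = 2 g, at least d values survive, so the path never wins.
-- For k = 4 g - 2 we have d (k + 1 - d) ≤ g k for every d, and arranging the predecessor
-- sets as arcs of ℤ/k makes each vertex decrease d by one, so a path of k vertices wins.
-- A long petal contains a segment of k vertices for each (s + 1)-tuple of stem colours.
module Submission where

open import Defs
import Data.Nat.Properties
open import Algebra.Properties.Semiring.Sum Data.Nat.Properties.+-*-semiring using
  (sum; sum-syntax; sum-cong-≗; ∑-comm; ∑-distrib-+; *-distribʳ-sum)
open import Data.Empty using (⊥)
open import Data.Fin using (Fin; zero; suc; toℕ; fromℕ<; inject≤; combine; remQuot; finToFun; funToFin)
open import Data.Fin.Properties using
  ( any?; all?; _≟_; ¬∀⟶∃¬; pigeonhole; toℕ<n; toℕ-injective; fromℕ<-toℕ; toℕ-fromℕ<; toℕ-inject≤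
  ; inject≤-injective; toℕ-combine; remQuot-combine; combine-remQuot; finToFun-funToFin )
open import Data.List as List using (List; []; _∷_; length; filter; allFin)
open import Data.List.Membership.Propositional using () renaming (_∈_ to _∈ₗ_)
open import Data.List.Membership.Propositional.Properties using (∈-filter⁺; ∈-filter⁻; ∈-allFin; ∈-lookup)
open import Data.List.Properties using (filter-≐)
open import Data.List.Relation.Unary.All as All using ()
open import Data.List.Relation.Unary.AllPairs using (_∷_)
open import Data.List.Relation.Unary.Any using (here; there)
open import Data.List.Relation.Unary.Unique.Propositional using (Unique)
open import Data.List.Relation.Unary.Unique.Propositional.Properties using (filter⁺; allFin⁺)
open import Data.Nat using
  (ℕ; zero; suc; _+_; _*_; _∸_; _^_; _≤_; _<_; z≤n; s≤s; z<s; s≤s⁻¹; _≤?_; _<?_; >-nonZero)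
open import Data.Nat.DivMod
open import Data.Nat.Divisibility using (divides-refl)
open import Data.Nat.Properties hiding (_≟_)
open import Data.Nat.Tactic.RingSolver using (solve-∀)
open import Data.Product using (_×_; ∃; _,_; proj₁; proj₂)
open import Data.Sum using (_⊎_; inj₁; inj₂)
open import Data.Unit using (⊤; tt)
open import Data.Vec using (Vec; []; _∷_; lookup; tabulate; replicate)
import Data.Vec.Membership.DecPropositional as DecMembership
open import Data.Vec.Membership.Propositional using (_∈_; _∉_)
open import Data.Vec.Membership.Propositional.Properties using (∈-tabulate⁺)
open import Data.Vec.Relation.Unary.Any using (index; here; there)
open import Data.Vec.Relation.Unary.Any.Properties using (lookup-index)
open import Function using (_∘_)
open import Relation.Binary.PropositionalEquality hiding ([_])
open import Relation.Nullary using (Dec; yes; no; contradiction)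
open import Relation.Nullary.Decidable using (¬?; _×-dec_; decidable-stable)
open import Relation.Unary using (Decidable)

-- Products of two numbers with bounded sum.

m≤o∧m+n≤1+2o⇒m*n≤o*[1+o] : ∀ m n o → m ≤ o → m + n ≤ suc (o + o) → m * n ≤ o * suc o
m≤o∧m+n≤1+2o⇒m*n≤o*[1+o] m n o m≤o m+n≤ with m≤n⇒∃[o]m+o≡n m≤o
-- With `o = m + e` and `n` as large as allowed, the product falls short of `o * suc o` by exactly
-- `e * suc e`.
... | e , refl = begin
  m * n                           ≤⟨ *-monoʳ-≤ m n≤ ⟩
  m * suc (m + e + e)             ≤⟨ m≤m+n _ (e * suc e) ⟩
  m * suc (m + e + e) + e * suc e ≡⟨ product m e ⟩
  (m + e) * suc (m + e)           ∎
  where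
  open ≤-Reasoning
  product : ∀ m e → m * suc (m + e + e) + e * suc e ≡ (m + e) * suc (m + e)
  product = solve-∀
  split : ∀ m e → suc (m + e + (m + e)) ≡ m + suc (m + e + e)
  split = solve-∀
  n≤ : n ≤ suc (m + e + e)
  n≤ = +-cancelˡ-≤ m _ _ (≤-trans m+n≤ (≤-reflexive (split m e)))

m+n≤1+2o⇒m*n≤o*[1+o] : ∀ m n o → m + n ≤ suc (o + o) → m * n ≤ o * suc o
m+n≤1+2o⇒m*n≤o*[1+o] m n o m+n≤ with ≤-<-connex m o
... | inj₁ m≤o = m≤o∧m+n≤1+2o⇒m*n≤o*[1+o] m n o m≤o m+n≤
... | inj₂ o<m = subst (_≤ o * suc o) (*-comm n m)
  (m≤o∧m+n≤1+2o⇒m*n≤o*[1+o] n m o n≤o (subst (_≤ suc (o + o)) (+-comm m n) m+n≤))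
  where
  n≤o : n ≤ o
  n≤o = +-cancelˡ-≤ (suc o) n o (≤-trans (+-monoˡ-≤ n o<m) m+n≤)

-- Shrinking arcs: a winning strategy on the path.

module PathWin (k' g : ℕ) (area : ∀ x y → x + y ≤ suc (suc k') → x * y ≤ g * suc k') where
  k = suc k'
  infix 4 _≈_
  _≈_ : ℕ → ℕ → Set
  m ≈ n = m % k ≡ n % k

  +-≈ : ∀ {a b c d} → a ≈ b → c ≈ d → a + c ≈ b + d
  +-≈ {a} {b} {c} {d} p q =
    trans (%-distribˡ-+ a c k) (trans (cong₂ (λ x y → (x + y) % k) p q) (sym (%-distribˡ-+ b d k)))

  *-≈ : ∀ {a b c d} → a ≈ b → c ≈ d → a * c ≈ b * d
  *-≈ {a} {b} {c} {d} p q =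
    trans (%-distribˡ-* a c k) (trans (cong₂ (λ x y → (x * y) % k) p q) (sym (%-distribˡ-* b d k)))

  difference : ∀ b t → ∃ λ e → e < k × b ≈ t + e
  -- Since `k'` is -1 modulo `k`, the witness is the residue of `b - t`.
  difference b t = (b + t * k') % k , m%n<n (b + t * k') k , (begin
    b % k                         ≡⟨ [m+kn]%n≡m%n b t k ⟨
    (b + t * k) % k               ≡⟨ cong (_% k) (eq b t k') ⟩
    (t + (b + t * k')) % k        ≡⟨ +-≈ {t} {t} {(b + t * k') % k} {b + t * k'} refl (m%n%n≡m%n (b + t * k') k) ⟨
    (t + (b + t * k') % k) % k    ∎)
    where
    open ≡-Reasoning
    eq : ∀ b t k' → b + t * suc k' ≡ t + (b + t * k')
    eq = solve-∀

  -- The colours a on the arc of ℤ/k of length d starting at b d.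
  OnArc : ℕ → ℕ → ℕ → Set
  OnArc d a b = ∃ λ i → i < d × a ≈ b * d + i

  onFullArc : ∀ a b → OnArc k a b
  onFullArc a b = difference a (b * k)

  -- With t = (c + 1) e, the colours t + j for 0 ≤ j ≤ k - d, d = e + 1, are those off
  -- the arc of length e of c.  Their arcs of length d lie end to end starting from t d,
  -- so they wrap around ℤ/k at most g times; q selects the winding on which a is met.
  -- The factor k' stands for -1 modulo k.
  guess : ℕ → ℕ → ℕ → ℕ → ℕ
  guess e a c q = t + ((a + t * d * k') % k + q * k) / d
    where
    d = suc e
    t = suc c * e

  -- If `b` is off the arc of `c`, then `b ≈ t + j` with `j ≤ k - d`, and `a` has offset
  -- `m = i + j * d` from `t * d`. The residue of `m` is known from `a` and `c`; the winding number
  -- `q = m / k` restores `m`, and `m / d` gives `j`.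
  guessed-or-shorterArc : ∀ e a b c → OnArc (suc e) a b →
    (∃ λ q → q < g × guess e a c q ≈ b) ⊎ OnArc e b c
  guessed-or-shorterArc e a b c (i , i<d , a≈) with difference b (c * e)
  ... | ε , ε<k , b≈ with ε <? e
  ...   | yes ε<e = inj₂ (ε , ε<e , b≈)
  ...   | no ε≮e with m≤n⇒∃[o]m+o≡n (≮⇒≥ ε≮e)
  ...     | j , refl = inj₁ (m / k , m<n*o⇒m/o<n m<gk , (begin
    (t + ((a + t * d * k') % k + m / k * k) / d) % k ≡⟨ cong (λ r → (t + (r + m / k * k) / d) % k) residue ⟩
    (t + (m % k + m / k * k) / d) % k                ≡⟨ cong (λ r → (t + r / d) % k) (m≡m%n+[m/n]*n m k) ⟨
    (t + m / d) % k                                  ≡⟨ cong (λ r → (t + r) % k) m/d≡j ⟩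
    (t + j) % k                                      ≡⟨ b≈t+j ⟨
    b % k                                            ∎))
    where
    open ≡-Reasoning
    d = suc e
    t = suc c * e
    m = i + j * d
    m<gk : m < g * k
    -- As `i < d`, `m < (j + 1) * d`; these two factors have sum at most `k + 1`, so `area` applies.
    m<gk = ≤-trans (+-monoˡ-≤ (j * d) i<d) (area (suc j) d (s≤s (subst (_≤ k) (eq j e) ε<k)))
      where
      eq : ∀ j e → suc (e + j) ≡ j + suc e
      eq = solve-∀
    b≈t+j : b ≈ t + j
    b≈t+j = trans b≈ (cong (_% k) (eq c e j))
      where
      eq : ∀ c e j → c * e + (e + j) ≡ suc c * e + j
      eq = solve-∀
    residue : a + t * d * k' ≈ m
    residue = begin
      (a + t * d * k') % k                 ≡⟨ +-≈ {a} {b * d + i} {t * d * k'} a≈ refl ⟩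
      (b * d + i + t * d * k') % k         ≡⟨ +-≈ {b * d + i} {(t + j) * d + i} {t * d * k'}
                                                (+-≈ {b * d} {(t + j) * d} {i} (*-≈ {b} {t + j} {d} b≈t+j refl) refl) refl ⟩
      ((t + j) * d + i + t * d * k') % k   ≡⟨ cong (_% k) (eq t j d i k') ⟩
      (m + t * d * k) % k                  ≡⟨ [m+kn]%n≡m%n m (t * d) k ⟩
      m % k                                ∎
      where
      eq : ∀ t j d i k' → (t + j) * d + i + t * d * k' ≡ i + j * d + t * d * suc k'
      eq = solve-∀
    m/d≡j : m / d ≡ j
    m/d≡j = trans (+-distrib-/-∣ʳ i (divides-refl j))
      (cong₂ _+_ (m<n⇒m/n≡0 i<d) (m*n/n≡m j d))

  -- Induction on `d`: a vertex that guesses wrong passes an arc shorter by one to the next pair. An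
  -- arc of length 0 is empty, hence no clause for `d = 0`.
  arc-wins : ∀ (C : ℕ → ℕ) d o → OnArc d (C o) (C (suc o)) →
    ∃ λ p → p < d × ∃ λ q → q < g × guess (d ∸ suc p) (C (o + p)) (C (2 + o + p)) q ≈ C (suc o + p)
  arc-wins C (suc e) o arc with guessed-or-shorterArc e (C o) (C (suc o)) (C (2 + o)) arc
  ... | inj₁ won = 0 , z<s ,
    subst (λ o+p → ∃ λ q → q < g × guess e (C o+p) (C (2 + o+p)) q ≈ C (suc o+p))
      (sym (+-identityʳ o)) won
  ... | inj₂ arc′ with arc-wins C e (suc o) arc′
  ...   | p , p<e , won = suc p , s≤s p<e ,
    subst (λ o+p → ∃ λ q → q < g × guess (e ∸ suc p) (C o+p) (C (2 + o+p)) q ≈ C (suc o+p))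
      (sym (+-suc o p)) won

-- Finite sums, indicators and extended colourings.

sum-mono : ∀ {n} {f g : Fin n → ℕ} → (∀ i → f i ≤ g i) → sum f ≤ sum g
sum-mono {zero} f≤g = z≤n
sum-mono {suc n} f≤g = +-mono-≤ (f≤g zero) (sum-mono (f≤g ∘ suc))

sum-const : ∀ n c → ∑[ i < n ] c ≡ n * c
sum-const zero c = refl
sum-const (suc n) c = cong (c +_) (sum-const n c)

term≤sum : ∀ {n} (f : Fin n → ℕ) i → f i ≤ sum f
term≤sum f zero = m≤m+n _ _
term≤sum f (suc i) = ≤-trans (term≤sum (f ∘ suc) i) (m≤n+m _ (f zero))

[_] : ∀ {P : Set} → Dec P → ℕ
[ yes _ ] = 1
[ no _ ] = 0

[-]-true : ∀ {P : Set} (P? : Dec P) → P → [ P? ] ≡ 1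
[-]-true (yes _) p = refl
[-]-true (no ¬p) p = contradiction p ¬p

[-]≤ : ∀ {P : Set} (P? : Dec P) {n} → (P → 1 ≤ n) → [ P? ] ≤ n
[-]≤ (yes p) 1≤n = 1≤n p
[-]≤ (no _) _ = z≤n

sum-positive⇒∃ : ∀ {n} {P : Fin n → Set} (P? : Decidable P) → 1 ≤ ∑[ i < n ] [ P? i ] → ∃ P
sum-positive⇒∃ {suc n} P? 1≤ with P? zero
... | yes p = zero , p
... | no _ with sum-positive⇒∃ (P? ∘ suc) 1≤
...   | i , p = suc i , p

sum-≟ : ∀ {n} (x : Fin n) → ∑[ i < n ] [ x ≟ i ] ≡ 1
sum-≟ {suc n} zero = cong suc (trans (sum-const n 0) (*-zeroʳ n))
sum-≟ {suc n} (suc x) = trans (sum-cong-≗ shift) (sum-≟ x)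
  where
  shift : ∀ i → [ suc x ≟ suc i ] ≡ [ x ≟ i ]
  shift i with x ≟ i
  ... | yes _ = refl
  ... | no _ = refl

extend : {A : Set} → ℕ → (ℕ → A) → A → ℕ → A
extend m C c j with j ≤? m
... | yes _ = C j
... | no _ = c

extend-old : ∀ {A : Set} m (C : ℕ → A) c {j} → j ≤ m → extend m C c j ≡ C j
extend-old m C c {j} j≤m with j ≤? m
... | yes _ = refl
... | no j≰m = contradiction j≤m j≰m

extend-new : ∀ {A : Set} m (C : ℕ → A) c {j} → m < j → extend m C c j ≡ c
extend-new m C c {j} m<j with j ≤? m
... | yes j≤m = contradiction j≤m (<⇒≱ m<j)
... | no _ = refl

-- Counting predecessors: the path loses for `k ≥ 4 g - 1`.

module PathLose {k g : ℕ} (1≤g : 1 ≤ g) (large : 4 * g ≤ suc k)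
  (L : ℕ → Fin k → Fin k → Fin g → Fin k) where
  Reach : ℕ → Fin k → Fin k → Set
  Reach zero a b = ⊤
  Reach (suc i) b c = ∃ λ a → Reach i a b × (∀ q → L i a c q ≢ b)

  reach? : ∀ i a b → Dec (Reach i a b)
  reach? zero a b = yes tt
  reach? (suc i) b c = any? λ a → reach? i a b ×-dec all? λ q → ¬? (L i a c q ≟ b)

  indegree : ℕ → Fin k → ℕ
  indegree i b = ∑[ a < k ] [ reach? i a b ]

  weight : ℕ → Fin k → Fin k → Fin k → ℕ
  weight i a b c = ∑[ q < g ] [ L i a c q ≟ b ]

  -- For fixed `c`, each pair of a left colour `a` and an index `q` yields one guess, which hits
  -- exactly one `b`; exchanging the sums counts these pairs.
  total-weight : ∀ i c → ∑[ b < k ] ∑[ a < k ] weight i a b c ≡ k * g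
  total-weight i c = begin
    ∑[ b < k ] ∑[ a < k ] weight i a b c               ≡⟨ ∑-comm (λ b a → weight i a b c) ⟩
    ∑[ a < k ] ∑[ b < k ] weight i a b c               ≡⟨ sum-cong-≗ (λ a → ∑-comm (λ b q → [ L i a c q ≟ b ])) ⟩
    ∑[ a < k ] ∑[ q < g ] ∑[ b < k ] [ L i a c q ≟ b ] ≡⟨ sum-cong-≗ (λ a → sum-cong-≗ (λ q → sum-≟ (L i a c q))) ⟩
    ∑[ a < k ] ∑[ q < g ] 1                            ≡⟨ sum-cong-≗ {k} (λ a → trans (sum-const g 1) (*-identityʳ g)) ⟩
    ∑[ a < k ] g                                       ≡⟨ sum-const k g ⟩
    k * g                                              ∎
    where open ≡-Reasoning

  -- If `(b , c)` is not reached, then `b` is among the guesses on seeing `a` and `c` for every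
  -- predecessor `a` of `b`, so excluding `b` costs at least `n` guesses.
  reach-or-weight : ∀ i b c n → n ≤ indegree i b →
    n ≤ [ reach? (suc i) b c ] * n + ∑[ a < k ] weight i a b c
  reach-or-weight i b c n n≤ with reach? (suc i) b c
  ... | yes _ = ≤-trans (≤-reflexive (sym (+-identityʳ n))) (m≤m+n _ _)
  ... | no unreachable = ≤-trans n≤ (sum-mono λ a → [-]≤ (reach? i a b) (heavy a))
    where
    heavy : ∀ a → Reach i a b → 1 ≤ weight i a b c
    heavy a r with any? (λ q → L i a c q ≟ b)
    ... | yes (q , eq) = subst (_≤ weight i a b c) ([-]-true (L i a c q ≟ b) eq)
      (term≤sum (λ q → [ L i a c q ≟ b ]) q)
    ... | no avoided = contradiction (a , r , λ q eq → avoided (q , eq)) unreachable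

  -- Summing `reach-or-weight` with `n = 2 g` over all `b` gives `2 g k ≤ 2 g d + g k`, hence
  -- `k ≤ 2 d`. With `d ≤ 2 g - 1` this would force `k ≤ 4 g - 2`.
  2g≤indegree : ∀ i b → g + g ≤ indegree i b
  2g≤indegree zero b = subst (g + g ≤_) (sym (trans (sum-const k 1) (*-identityʳ k))) (s≤s⁻¹ (begin
    suc (g + g)       ≤⟨ +-monoˡ-≤ (g + g) (≤-trans 1≤g (m≤m+n g g)) ⟩
    g + g + (g + g)   ≡⟨ eq g ⟩
    4 * g             ≤⟨ large ⟩
    suc k             ∎))
    where
    open ≤-Reasoning
    eq : ∀ g → g + g + (g + g) ≡ 4 * g
    eq = solve-∀
  2g≤indegree (suc i) c = ≮⇒≥ λ d<2g → <-irrefl refl (begin-strict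
    suc (d + d)             <⟨ ≤-reflexive (sym (cong suc (+-suc d d))) ⟩
    suc d + suc d           ≤⟨ +-mono-≤ d<2g d<2g ⟩
    g + g + (g + g)         ≡⟨ eq₁ g ⟩
    4 * g                   ≤⟨ large ⟩
    suc k                   ≤⟨ s≤s k≤2d ⟩
    suc (d + d)             ∎)
    where
    open ≤-Reasoning
    d = indegree (suc i) c
    eq₁ : ∀ g → g + g + (g + g) ≡ 4 * g
    eq₁ = solve-∀
    eq₂ : ∀ k g → k * g + k * g ≡ k * (g + g)
    eq₂ = solve-∀
    eq₃ : ∀ d g → d * (g + g) ≡ (d + d) * g
    eq₃ = solve-∀
    counted : k * (g + g) ≤ d * (g + g) + k * g
    counted = begin
      k * (g + g) ≡⟨ sum-const k (g + g) ⟨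
      ∑[ b < k ] (g + g) ≤⟨ sum-mono (λ b → reach-or-weight i b c (g + g) (2g≤indegree i b)) ⟩
      ∑[ b < k ] ([ reach? (suc i) b c ] * (g + g) + ∑[ a < k ] weight i a b c)
        ≡⟨ ∑-distrib-+ {k} _ _ ⟩
      ∑[ b < k ] ([ reach? (suc i) b c ] * (g + g)) + ∑[ b < k ] ∑[ a < k ] weight i a b c
        ≡⟨ cong₂ _+_ (sym (*-distribʳ-sum {k} (g + g) _)) (total-weight i c) ⟩
      d * (g + g) + k * g ∎
    k≤2d : k ≤ d + d
    k≤2d = *-cancelʳ-≤ k (d + d) g {{>-nonZero 1≤g}}
      (subst (k * g ≤_) (eq₃ d g)
        (+-cancelʳ-≤ (k * g) (k * g) _ (subst (_≤ d * (g + g) + k * g) (sym (eq₂ k g)) counted)))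

  -- C 0 is a dummy left neighbour, and vertex i has colour C (suc i).
  Avoids : (ℕ → Fin k) → ℕ → Set
  Avoids C i = ∀ q → L i (C i) (C (2 + i)) q ≢ C (suc i)

  avoid-cong : ∀ {C D i} → D i ≡ C i → D (suc i) ≡ C (suc i) → D (2 + i) ≡ C (2 + i) →
    Avoids C i → Avoids D i
  avoid-cong e₀ e₁ e₂ avoid rewrite e₀ | e₁ | e₂ = avoid

  -- Avoidance at `i < m` reads colours up to index `m + 1` only, so placing `c` from index `m + 2`
  -- on preserves it and adds the condition at `m`.
  trace : ∀ m a b → Reach m a b →
    ∃ λ C → C m ≡ a × C (suc m) ≡ b × (∀ i → i < m → Avoids C i)
  trace zero a b _ = (λ { zero → a ; (suc _) → b }) , refl , refl , λ _ ()
  trace (suc m) b c (a , r , avoid) with trace m a b r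
  ... | C , refl , refl , avoids = D , old ≤-refl , extend-new (suc m) C c ≤-refl , avoids′
    where
    D = extend (suc m) C c
    old : ∀ {j} → j ≤ suc m → D j ≡ C j
    old = extend-old (suc m) C c
    avoids′ : ∀ i → i < suc m → Avoids D i
    avoids′ i (s≤s i≤m) with m≤n⇒m<n∨m≡n i≤m
    ... | inj₁ i<m = avoid-cong {C} {D} (old (m≤n⇒m≤1+n i≤m)) (old (s≤s i≤m)) (old (s≤s i<m)) (avoids i i<m)
    ... | inj₂ refl rewrite old (n≤1+n m) | old (≤-refl {suc m}) | extend-new (suc m) C c (≤-refl {2 + m}) = avoid

  path-loses : ∀ n → ∃ λ C → ∀ i → i < n → Avoids C i
  path-loses n with sum-positive⇒∃ (λ a → reach? n a colour)
    (≤-trans 1≤g (≤-trans (m≤m+n g g) (2g≤indegree n colour)))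
    where
    0<k : 0 < k
    0<k = s≤s⁻¹ (≤-trans (+-mono-≤ 1≤g (≤-trans 1≤g (m≤m+n g _))) large)
    colour = fromℕ< 0<k
  ... | a , r with trace n a _ r
  ...   | C , _ , _ , avoids = C , avoids

-- Petals: the upper bound from `s + 1` stem colours.

module _ {n k : ℕ} where
  recolour-stem : Fin k → (ℕ → Fin k) → Coloring (Petal n) k
  recolour-stem x C zero = x
  recolour-stem x C (suc j) = C (suc (toℕ j))

  module _ {s : ℕ} (s<k : suc s ≤ k) (f : Guessing (Petal n) s k)
    (local : SeesOnlyNeighbours (Petal n) s k f) where
    stem-colour : Fin (suc s) → Fin k
    stem-colour r = inject≤ r s<k

    -- To evaluate `f` from two neighbour colours, the path is coloured `a` before vertex `i` and
    -- `c` from `i` on; by locality only the stem and the two neighbours count.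
    guessAt : ∀ i → Dec (i < n) → Fin k → Fin k → Fin (suc s) × Fin s → Fin k
    guessAt i (yes i<n) a c (r , j) =
      lookup (f (suc (fromℕ< i<n)) (recolour-stem (stem-colour r) (extend i (λ _ → a) c))) j
    guessAt i (no _) a c _ = a

    guessAt-toℕ : ∀ i i<n? a c r j → guessAt (toℕ i) i<n? a c (r , j) ≡
      lookup (f (suc i) (recolour-stem (stem-colour r) (extend (toℕ i) (λ _ → a) c))) j
    guessAt-toℕ i (yes i<n) a c r j rewrite fromℕ<-toℕ i i<n = refl
    guessAt-toℕ i (no i≮n) a c r j = contradiction (toℕ<n i) i≮n

    unionGuess : ℕ → Fin k → Fin k → Fin (suc s * s) → Fin k
    unionGuess i a c q = guessAt i (i <? n) a c (remQuot s q)

    unionGuess-combine : ∀ i a c r j → unionGuess (toℕ i) a c (combine r j) ≡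
      lookup (f (suc i) (recolour-stem (stem-colour r) (extend (toℕ i) (λ _ → a) c))) j
    unionGuess-combine i a c r j =
      trans (cong (guessAt (toℕ i) (toℕ i <? n) a c) (remQuot-combine r j)) (guessAt-toℕ i (toℕ i <? n) a c r j)

    see-extension : ∀ C x i →
      f (suc i) (recolour-stem x (extend (toℕ i) (λ _ → C (toℕ i)) (C (2 + toℕ i)))) ≡ f (suc i) (recolour-stem x C)
    see-extension C x i = local (suc i) _ _ same
      where
      same : ∀ u → PetalAdj n (suc i) u →
        recolour-stem x (extend (toℕ i) (λ _ → C (toℕ i)) (C (2 + toℕ i))) u ≡ recolour-stem x C u
      same zero _ = refl
      same (suc j) (inj₁ eq) = trans (extend-new (toℕ i) _ _ (m≤n⇒m≤1+n (≤-reflexive eq))) (cong (λ m → C (suc m)) eq)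
      same (suc j) (inj₂ eq) = trans (extend-old (toℕ i) _ _ (≤-reflexive eq)) (cong C (sym eq))

    path-wrong : ∀ C i r → (∀ q → unionGuess (toℕ i) (C (toℕ i)) (C (2 + toℕ i)) q ≢ C (suc (toℕ i))) →
      C (suc (toℕ i)) ∉ f (suc i) (recolour-stem (stem-colour r) C)
    path-wrong C i r avoids right = avoids (combine r (index right))
      (trans (unionGuess-combine i _ _ r (index right))
        (trans (cong (λ v → lookup v (index right)) (see-extension C (stem-colour r) i)) (sym (lookup-index right))))

    -- No path vertex is right under any of the `s + 1` stem colours, so the stem must be. It does
    -- not see itself, so its list is the same each time.
    stem-guesses : (∀ c → ∃ λ v → c v ∈ f v c) → ∀ C →
      (∀ i → i < n → ∀ q → unionGuess i (C i) (C (2 + i)) q ≢ C (suc i)) →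
      ∀ r → stem-colour r ∈ f zero (recolour-stem (stem-colour zero) C)
    stem-guesses wins C avoids r with wins (recolour-stem (stem-colour r) C)
    ... | suc i , right = contradiction right (path-wrong C i r (avoids (toℕ i) (toℕ<n i)))
    ... | zero , right = subst (stem-colour r ∈_) (local zero _ _ λ { zero () ; (suc _) _ → refl }) right

  petal-loses : ∀ s → 1 ≤ s → suc s ≤ k → 4 * (suc s * s) ≤ suc k → Winning (Petal n) s k → ⊥
  petal-loses s 1≤s s<k large (f , local , wins)
    with PathLose.path-loses (≤-trans 1≤s (m≤m+n s _)) large (unionGuess s<k f local) n
  ... | C , avoids = conclude
    where
    guessed = stem-guesses s<k f local wins C avoids
    conclude : ⊥
    -- The `s + 1` distinct colours would share the `s` places of one list.
    conclude with pigeonhole ≤-refl (λ r → index (guessed r))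
    ... | r , r′ , r<r′ , eq = <-irrefl (cong toℕ (inject≤-injective s<k s<k r r′ same-colour)) r<r′
      where
      same-colour : inject≤ r s<k ≡ inject≤ r′ s<k
      same-colour = trans (lookup-index (guessed r))
        (trans (cong (lookup (f zero (recolour-stem (inject≤ {suc s} zero s<k) C))) eq) (sym (lookup-index (guessed r′))))

-- Long petals: one path segment per tuple of stem colours.

lookup-injective : ∀ {A : Set} {xs : List A} → Unique xs → ∀ i j → List.lookup xs i ≡ List.lookup xs j → i ≡ j
lookup-injective (_ ∷ _) zero zero eq = refl
lookup-injective {xs = _ ∷ xs} (x∉xs ∷ _) zero (suc j) eq = contradiction eq (All.lookup x∉xs (∈-lookup j))
lookup-injective {xs = _ ∷ xs} (x∉xs ∷ _) (suc i) zero eq = contradiction (sym eq) (All.lookup x∉xs (∈-lookup i))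
lookup-injective (_ ∷ unique) (suc i) (suc j) eq = cong suc (lookup-injective unique i j eq)

padTo : ∀ {A : Set} → A → ∀ s → List A → Vec A s
padTo d zero _ = []
padTo d (suc s) [] = d ∷ padTo d s []
padTo d (suc s) (x ∷ xs) = x ∷ padTo d s xs

∈-padTo : ∀ {A : Set} {d x : A} {s} {xs} → length xs ≤ s → x ∈ₗ xs → x ∈ padTo d s xs
∈-padTo (s≤s len) (here eq) = here eq
∈-padTo (s≤s len) (there x∈) = there (∈-padTo len x∈)

module PetalWin (k' s n : ℕ) (area : ∀ x y → x + y ≤ suc (suc k') → x * y ≤ suc s * s * suc k')
  (long : suc k' ^ suc s * suc k' ≤ n) where
  open PathWin k' (suc s * s) area

  module _ (c : Coloring (Petal n) k) where
    colourIf : ∀ {j} → Dec (j < n) → ℕ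
    colourIf (yes j<n) = toℕ (c (suc (fromℕ< j<n)))
    colourIf (no _) = 0

    -- Shifted by one as in Avoids; the dummy value 0 is harmless since the first vertex
    -- of a segment starts from the full arc and the last one from an arc of length 1.
    colour : ℕ → ℕ
    colour zero = 0
    colour (suc j) = colourIf (j <? n)

  colour-local : ∀ c c' m → (∀ j → suc (toℕ j) ≡ m → c (suc j) ≡ c' (suc j)) → colour c m ≡ colour c' m
  colour-local c c' zero same = refl
  colour-local c c' (suc j) same with j <? n
  ... | yes j<n = cong toℕ (same (fromℕ< j<n) (cong suc (toℕ-fromℕ< j<n)))
  ... | no _ = refl

  colour-toℕ : ∀ c i → colour c (suc (toℕ i)) ≡ toℕ (c (suc i))
  colour-toℕ c i = at (toℕ i <? n)
    where
    at : ∀ i<n? → colourIf c {toℕ i} i<n? ≡ toℕ (c (suc i))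
    at (yes i<n) = cong (λ j → toℕ (c (suc j))) (fromℕ<-toℕ i i<n)
    at (no i≮n) = contradiction (toℕ<n i) i≮n

  -- Encodes a choice of s + 1 stem colours.
  Tuple : Set
  Tuple = Fin (k ^ suc s)

  module _ (a c : ℕ) where
    entry : Fin k → Fin (suc s) → Fin s → Fin k
    entry p r j = guess (k' ∸ toℕ p) a c (toℕ (combine r j)) mod k

    -- The `s (s + 1)` guesses of the path strategy are split into `s + 1` shares of `s`. Under stem
    -- colour `x` the share at an index of `x` in the tuple is named; if `x` is absent, the list is
    -- filler.
    shareOf : ∀ {x} (u : Tuple) → Dec (∃ λ r → finToFun u r ≡ x) → Fin k → Vec (Fin k) s
    shareOf u (yes (r , _)) p = tabulate (entry p r)
    shareOf u (no _) p = replicate s zero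

    segmentGuess : Fin k → Tuple × Fin k → Vec (Fin k) s
    segmentGuess x (u , p) = shareOf u (any? λ r → finToFun u r ≟ x) p

    positionGuess : Fin k → ∀ {i} → Dec (i < k ^ suc s * k) → Vec (Fin k) s
    positionGuess x (yes i<) = segmentGuess x (remQuot k (fromℕ< i<))
    positionGuess x (no _) = replicate s zero

    positionGuess-combine : ∀ x u p {i} (i<? : Dec (i < k ^ suc s * k)) → i ≡ toℕ (combine u p) →
      positionGuess x i<? ≡ segmentGuess x (u , p)
    positionGuess-combine x u p (yes i<) refl = cong (segmentGuess x)
      (trans (cong (remQuot k) (fromℕ<-toℕ (combine u p) i<)) (remQuot-combine u p))
    positionGuess-combine x u p (no i≮) refl = contradiction (toℕ<n (combine u p)) i≮

    entry∈segmentGuess : ∀ (τ : Fin (suc s) → Fin k) → (∀ r r′ → τ r ≡ τ r′ → r ≡ r′) → ∀ p r j →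
      entry p r j ∈ segmentGuess (τ r) (funToFin τ , p)
    entry∈segmentGuess τ τ-injective p r j = share (any? λ r′ → finToFun (funToFin τ) r′ ≟ τ r)
      where
      share : ∀ r? → entry p r j ∈ shareOf {τ r} (funToFin τ) r? p
      share (yes (r′ , eq)) with refl ← τ-injective r′ r (trans (sym (finToFun-funToFin τ r′)) eq) =
        ∈-tabulate⁺ (entry p r) j
      share (no ∄r) = contradiction (r , finToFun-funToFin τ r) ∄r

  vertexGuess : Coloring (Petal n) k → Fin k → Fin n → Vec (Fin k) s
  vertexGuess c x i = positionGuess (colour c (toℕ i)) (colour c (2 + toℕ i)) x (toℕ i <? k ^ suc s * k)

  vertexGuess-local : ∀ c c' x i →
    (∀ j → suc (toℕ i) ≡ toℕ j ⊎ suc (toℕ j) ≡ toℕ i → c (suc j) ≡ c' (suc j)) →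
    vertexGuess c x i ≡ vertexGuess c' x i
  vertexGuess-local c c' x i same = cong₂ (λ a b → positionGuess a b x (toℕ i <? k ^ suc s * k))
    (colour-local c c' (toℕ i) λ j eq → same j (inj₂ eq))
    (colour-local c c' (2 + toℕ i) λ j eq → same j (inj₁ (sym (suc-injective eq))))

  Loses : Coloring (Petal n) k → Fin k → Set
  Loses c x = ∀ i → c (suc i) ∉ vertexGuess c x i

  guessed? : ∀ c x i → Dec (c (suc i) ∈ vertexGuess c x i)
  guessed? c x i = DecMembership._∈?_ _≟_ (c (suc i)) (vertexGuess c x i)

  loses? : ∀ c x → Dec (Loses c x)
  loses? c x = all? λ i → ¬? (guessed? c x i)

  loses-cong : ∀ {c c'} → (∀ i → c (suc i) ≡ c' (suc i)) → ∀ {x} → Loses c x → Loses c' x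
  loses-cong {c} {c'} same {x} loses i =
    subst₂ (λ x xs → x ∉ xs) (same i) (vertexGuess-local c c' x i λ j _ → same j) (loses i)

  -- The segment encoded by `τ` starts at `o` from the full arc, so some guess `q` in it is right;
  -- decoding `q` gives the index `r` of the stem colour whose share contains that guess.
  one-wins : ∀ c (τ : Fin (suc s) → Fin k) → (∀ r r′ → τ r ≡ τ r′ → r ≡ r′) →
    ∃ λ r → ∃ λ i → c (suc i) ∈ vertexGuess c (τ r) i
  one-wins c τ τ-injective with (let o = k * toℕ (funToFin τ) in arc-wins (colour c) k o (onFullArc (colour c o) (colour c (suc o))))
  ... | p , p<k , q , q<g , won = r , i ,
    subst₂ (λ x xs → x ∈ xs) (sym right) (sym place) (entry∈segmentGuess _ _ τ τ-injective p′ r j)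
    where
    u = funToFin τ
    p′ = fromℕ< p<k
    r = proj₁ (remQuot {suc s} s (fromℕ< q<g))
    j = proj₂ (remQuot {suc s} s (fromℕ< q<g))
    i = inject≤ (combine u p′) long
    i≡ : toℕ i ≡ toℕ (combine u p′)
    i≡ = toℕ-inject≤ (combine u p′) long
    i≡o+p : toℕ i ≡ k * toℕ u + p
    i≡o+p = trans i≡ (trans (toℕ-combine u p′) (cong (k * toℕ u +_) (toℕ-fromℕ< p<k)))
    a = colour c (toℕ i)
    b = colour c (2 + toℕ i)
    place : vertexGuess c (τ r) i ≡ segmentGuess a b (τ r) (u , p′)
    place = positionGuess-combine a b (τ r) u p′ (toℕ i <? k ^ suc s * k) i≡
    q≡ : toℕ (combine r j) ≡ q
    q≡ = trans (cong toℕ (combine-remQuot {suc s} s (fromℕ< q<g))) (toℕ-fromℕ< q<g)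
    right : c (suc i) ≡ entry a b p′ r j
    right = toℕ-injective (begin
      toℕ (c (suc i))                    ≡⟨ m<n⇒m%n≡m (toℕ<n (c (suc i))) ⟨
      toℕ (c (suc i)) % k                ≡⟨ cong (_% k) (colour-toℕ c i) ⟨
      colour c (suc (toℕ i)) % k         ≡⟨ subst (λ m → guess (k' ∸ p) (colour c m) (colour c (2 + m)) q ≈ colour c (suc m))
                                              (sym i≡o+p) won ⟨
      guess (k' ∸ p) a b q % k           ≡⟨ cong₂ (λ p q → guess (k' ∸ p) a b q % k) (toℕ-fromℕ< p<k) q≡ ⟨
      guess (k' ∸ toℕ p′) a b (toℕ (combine r j)) % k
                                         ≡⟨ toℕ-fromℕ< (m%n<n (guess (k' ∸ toℕ p′) a b (toℕ (combine r j))) k) ⟨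
      toℕ (entry a b p′ r j)             ∎)
      where open ≡-Reasoning

  losing : Coloring (Petal n) k → List (Fin k)
  losing c = filter (loses? c) (allFin k)

  -- More than `s` losing stem colours would yield an injective tuple refuted by `one-wins`. Hence
  -- the stem can list every losing colour.
  few-losing : ∀ c → length (losing c) ≤ s
  few-losing c = ≮⇒≥ too-many
    where
    unique : Unique (losing c)
    unique = filter⁺ (loses? c) (allFin⁺ k)
    all-lose : ∀ j → Loses c (List.lookup (losing c) j)
    all-lose j = proj₂ (∈-filter⁻ (loses? c) {xs = allFin k} (∈-lookup {xs = losing c} j))
    too-many : s < length (losing c) → ⊥
    too-many s<len = refute (one-wins c τ λ r r′ eq →
      inject≤-injective s<len s<len r r′ (lookup-injective unique _ _ eq))
      where
      τ : Fin (suc s) → Fin k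
      τ r = List.lookup (losing c) (inject≤ r s<len)
      refute : (∃ λ r → ∃ λ i → c (suc i) ∈ vertexGuess c (τ r) i) → ⊥
      refute (r , i , right) = all-lose (inject≤ r s<len) i right

  strategy : Guessing (Petal n) s k
  strategy zero c = padTo zero s (losing c)
  strategy (suc i) c = vertexGuess c (c zero) i

  strategy-local : SeesOnlyNeighbours (Petal n) s k strategy
  strategy-local zero c c' same = cong (padTo zero s) (filter-≐ (loses? c) (loses? c')
    (loses-cong (λ i → same (suc i) _) , loses-cong (λ i → sym (same (suc i) _))) (allFin k))
  strategy-local (suc i) c c' same = trans (cong (λ x → vertexGuess c x i) (same zero _))
    (vertexGuess-local c c' (c' zero) i λ j → same (suc j))

  strategy-wins : ∀ c → ∃ λ v → c v ∈ strategy v c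
  strategy-wins c with loses? c (c zero)
  ... | yes loses = zero , ∈-padTo (few-losing c) (∈-filter⁺ (loses? c) (∈-allFin (c zero)) loses)
  ... | no ¬loses with ¬∀⟶∃¬ n _ (λ i → ¬? (guessed? c (c zero) i)) ¬loses
  ...   | i , right = suc i , decidable-stable (guessed? c (c zero) i) right

  petal-wins : Winning (Petal n) s k
  petal-wins = strategy , strategy-local , strategy-wins

-- The exact value for petals.

petal-HG< : ∀ s → 1 ≤ s → ∀ n → HG< (Petal n) s (4 * s * (s + 1) ∸ 1)
petal-HG< s 1≤s n k K≤k = petal-loses s 1≤s (s≤s⁻¹ (≤-trans small large)) large
  where
  open ≤-Reasoning
  4g≡ : ∀ s → 4 * (suc s * s) ≡ 4 * s * (s + 1)
  4g≡ = solve-∀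
  large : 4 * (suc s * s) ≤ suc k
  large = begin
    4 * (suc s * s)               ≡⟨ 4g≡ s ⟩
    4 * s * (s + 1)               ≤⟨ m≤n+m∸n (4 * s * (s + 1)) 1 ⟩
    suc (4 * s * (s + 1) ∸ 1)     ≤⟨ s≤s K≤k ⟩
    suc k                         ∎
  -- Together with `large` this gives `s + 1 ≤ k`, enough colours for the stem.
  small : 2 + s ≤ 4 * (suc s * s)
  small = begin
    2 + s                   ≤⟨ s≤s (+-monoˡ-≤ s 1≤s) ⟩
    suc s + s               ≤⟨ +-mono-≤ (m≤m*n (suc s) s {{>-nonZero 1≤s}}) (m≤n*m s (suc s)) ⟩
    suc s * s + suc s * s   ≤⟨ +-monoʳ-≤ (suc s * s) (m≤m+n _ _) ⟩
    4 * (suc s * s)         ∎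

petal-HG≡ : ∀ s → 1 ≤ s → ∃ λ N → ∀ n → N ≤ n → HG≡ (Petal n) s (4 * s * (s + 1) ∸ 2)
petal-HG≡ s@(suc t) 1≤s = k ^ suc s * k , λ n long →
  subst (λ K → Winning (Petal n) s (K ∸ 2)) (sym (4s[s+1]≡2+k t))
    (PetalWin.petal-wins (m + suc m) s n area long) ,
  subst (HG< (Petal n) s)
    (trans (cong (_∸ 1) (4s[s+1]≡2+k t)) (sym (cong (λ K → suc (K ∸ 2)) (4s[s+1]≡2+k t))))
    (petal-HG< s 1≤s n)
  where
  -- For `g = s (s + 1)` this is `2 g - 2`, so `suc m = 2 g - 1` is half of `k = 4 g - 2`.
  m = 2 * (t * t) + 6 * t + 2
  k = suc m + suc m
  4s[s+1]≡2+k : ∀ t → 4 * suc t * (suc t + 1) ≡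
    2 + (suc (2 * (t * t) + 6 * t + 2) + suc (2 * (t * t) + 6 * t + 2))
  4s[s+1]≡2+k = solve-∀
  -- This is `(2 g - 1) (2 g) = g (4 g - 2)`: the area bound is attained by the most balanced
  -- factors.
  balanced : ∀ t → suc (2 * (t * t) + 6 * t + 2) * (2 + (2 * (t * t) + 6 * t + 2)) ≡
    (2 + t) * suc t * (suc (2 * (t * t) + 6 * t + 2) + suc (2 * (t * t) + 6 * t + 2))
  balanced = solve-∀
  area : ∀ x y → x + y ≤ suc k → x * y ≤ suc s * s * k
  area x y x+y≤ = ≤-trans (m+n≤1+2o⇒m*n≤o*[1+o] x y (suc m) x+y≤) (≤-reflexive (balanced t))

theorem3p8 : (s : ℕ) → 1 ≤ s →
    ((n : ℕ) → 1 ≤ n → HG< (Petal n) s (4 * s * (s + 1) ∸ 1))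
    × (∃ λ N → (n : ℕ) → N ≤ n → HG≡ (Petal n) s (4 * s * (s + 1) ∸ 2))
theorem3p8 s 1≤s = (λ n _ → petal-HG< s 1≤s n) , petal-HG≡ s 1≤s
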